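{- If $T$ is a strongly connected tournament on $n\ge 3$ vertices, then $3\le\overrightarrow{trc}(T)\le\overrightarrow{strc}(T)\le 2n-3$.
   Context: A tournament is a digraph in which every two distinct vertices are joined by exactly one arc (in one direction), with no loops. Strongly connected means every ordered pair $(u,v)$ is joined by a directed $u$–$v$ path; a geodesic is a shortest directed path. A directed path is total-rainbow if its arcs and internal vertices all receive pairwise distinct colours under a total-colouring (colouring of vertices and arcs). $\overrightarrow{trc}(D)$ (resp. $\overrightarrow{strc}(D)$) is the minimum number of colours in a total-colouring of $D$ such that every ordered pair $(u,v)$ is joined by a total-rainbow $u$–$v$ path (resp. total-rainbow $u$–$v$ geodesic). -}

module Defs where

open import Data.Nat using (ℕ; _<_; _≤_)
open import Data.Fin using (Fin)
open import Data.Bool using (Bool; true; false; not; T)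
open import Data.List using (List; []; _∷_; _++_; map; length)
open import Data.List.Relation.Unary.Unique.Propositional using (Unique)
open import Data.Product using (Σ; ∃; _×_)
open import Relation.Binary.PropositionalEquality using (_≡_; _≢_)
open import Relation.Nullary using (¬_)

record Tournament (n : ℕ) : Set where
  field
    adj    : Fin n → Fin n → Bool
    irrefl : ∀ v → adj v v ≡ false
    oneArc : ∀ u v → u ≢ v → adj u v ≡ not (adj v u)

open Tournament public

Arc : ∀ {n} → Tournament n → Fin n → Fin n → Set
Arc D u v = T (adj D u v)

data Walk {n} (D : Tournament n) : Fin n → Fin n → List (Fin n) → Set where
  here : ∀ {u} → Walk D u u (u ∷ [])
  step : ∀ {u w v p} → Arc D u w → Walk D w v p → Walk D u v (u ∷ p)

IsPath : ∀ {n} → Tournament n → Fin n → Fin n → List (Fin n) → Set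
IsPath D u v p = Walk D u v p × Unique p

StronglyConnected : ∀ {n} → Tournament n → Set
StronglyConnected D = ∀ u v → ∃ λ p → IsPath D u v p

IsGeodesic : ∀ {n} → Tournament n → Fin n → Fin n → List (Fin n) → Set
IsGeodesic D u v p = IsPath D u v p × (∀ q → IsPath D u v q → length p ≤ length q)

-- A total-colouring with (at most) k colours: colours on vertices and on arcs
-- (values of acol on non-arcs are irrelevant).
record TotalColouring (n k : ℕ) : Set where
  field
    vcol : Fin n → Fin k
    acol : Fin n → Fin n → Fin k

open TotalColouring public

dropLast : ∀ {A : Set} → List A → List A
dropLast []           = []
dropLast (x ∷ [])     = []
dropLast (x ∷ y ∷ xs) = x ∷ dropLast (y ∷ xs)

interior : ∀ {A : Set} → List A → List A
interior []       = []
interior (x ∷ xs) = dropLast xs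

arcColours : ∀ {n k} → TotalColouring n k → List (Fin n) → List (Fin k)
arcColours c []           = []
arcColours c (x ∷ [])     = []
arcColours c (x ∷ y ∷ xs) = acol c x y ∷ arcColours c (y ∷ xs)

TotalRainbow : ∀ {n k} → TotalColouring n k → List (Fin n) → Set
TotalRainbow c p = Unique (arcColours c p ++ map (vcol c) (interior p))

TRConnecting : ∀ {n k} → Tournament n → TotalColouring n k → Set
TRConnecting D c = ∀ u v → u ≢ v → ∃ λ p → IsPath D u v p × TotalRainbow c p

STRConnecting : ∀ {n k} → Tournament n → TotalColouring n k → Set
STRConnecting D c = ∀ u v → u ≢ v → ∃ λ p → IsGeodesic D u v p × TotalRainbow c p

IsTRC : ∀ {n} → Tournament n → ℕ → Set
IsTRC {n} D k = (∃ λ (c : TotalColouring n k) → TRConnecting D c)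
              × (∀ j → j < k → ¬ (∃ λ (c : TotalColouring n j) → TRConnecting D c))

IsSTRC : ∀ {n} → Tournament n → ℕ → Set
IsSTRC {n} D k = (∃ λ (c : TotalColouring n k) → STRConnecting D c)
               × (∀ j → j < k → ¬ (∃ λ (c : TotalColouring n j) → STRConnecting D c))

{-# OPTIONS --safe #-}

-- Upper bound: give an arc a colour depending only on its head, and take
-- vertex colours from a disjoint palette; it remains to identify colours that no
-- chosen geodesic shows twice. If d(x,y) ≥ 3 then y dominates x and no geodesic
-- passes through y and then x, except possibly one starting at y. Hence a
-- diametral pair x, y may share its arc colour, leaving n − 1 arc colours, and
-- pairs of distance at least 3 and at least the diameter minus 1 may share their
-- vertex colour. For diameter d ≥ 4 and a diametral path x₀ … x_d, the pairs
-- {x₀, x_{d−1}} and {x₁, x_d} leave n − 2 vertex colours. For diameter 3 use two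
-- disjoint pairs at distance 3, or two pairs sharing a vertex (then all three
-- vertices may be identified), or, if there is only one pair at distance 3, two
-- vertex colours by distance from its first vertex. For diameter 2 one vertex colour
-- and n arc colours are enough when n ≥ 4, and n = 3 is done by hand.
--
-- Lower bound: a total-rainbow path between vertices not joined by an arc shows
-- two arcs and an internal vertex.
module Submission where

open import Defs
open import Data.Bool using (T; T?; true; false; not)
open import Data.Fin as Fin using (Fin; zero; suc; _↑ˡ_; _↑ʳ_; splitAt; inject≤; punchOut)
open import Data.Fin.Patterns using (0F; 1F; 2F)
open import Data.Fin.Properties as Fin using (any?; all?; pigeonhole; punchOut-injective;
  inject≤-injective; splitAt-↑ˡ; splitAt-↑ʳ; ↑ˡ-injective; ↑ʳ-injective)
open import Data.List using (List; []; _∷_; _++_; map; length; lookup; allFin)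
open import Data.List.Membership.Propositional.Properties using (∈-lookup; ∈-allFin)
open import Data.List.Properties using (map-cong; length-++)
open import Data.List.Relation.Unary.All as All using (All; []; _∷_)
import Data.List.Relation.Unary.All.Properties as All
open import Data.List.Relation.Unary.AllPairs as AllPairs using (AllPairs; []; _∷_)
import Data.List.Relation.Unary.AllPairs.Properties as AllPairs
open import Data.List.Relation.Unary.Unique.Propositional using (Unique)
import Data.List.Relation.Unary.Unique.DecPropositional as DecUnique
open import Data.Nat using (ℕ; zero; suc; _+_; _∸_; _*_; _≤_; _<_; z≤n; s≤s; s≤s⁻¹; _≤?_)
open import Data.Nat.Properties
open import Data.List.Extrema ≤-totalOrder using (argmax; f[xs]≤f[argmax])
open import Data.Nat.Tactic.RingSolver using (solve-∀)
open import Data.Product using (∃; ∃₂; _×_; _,_; proj₁; proj₂)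
open import Data.Sum using (_⊎_; inj₁; inj₂; [_,_]; swap)
open import Data.Vec.Functional as Vector using (Vector)
open import Function using (_∘_; id)
open import Level using (0ℓ)
open import Relation.Binary using (Rel)
open import Relation.Binary.PropositionalEquality hiding ([_])
open import Relation.Nullary using (¬_; Dec; yes; no; contradiction)
open import Relation.Nullary.Decidable using (map′; ¬?; _×-dec_; _⊎-dec_; _→-dec_; from-yes; decidable-stable)
open import Relation.Unary using (Decidable)

-- Deciding by finite search whether a connecting colouring exists.

least : ∀ {P : ℕ → Set} → Decidable P → ∀ k → P k →
  ∃ λ m → m ≤ k × P m × (∀ j → j < m → ¬ P j)
least P? k pk with P? 0
... | yes p0 = 0 , z≤n , p0 , λ _ ()
least P? zero    pk | no ¬p0 = contradiction pk ¬p0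
least {P} P? (suc k) pk | no ¬p0 with least (P? ∘ suc) k pk
... | m , m≤k , pm , min = suc m , s≤s m≤k , pm , min′
  where
  min′ : ∀ j → j < suc m → ¬ P j
  min′ zero    _         = ¬p0
  min′ (suc j) (s≤s j<m) = min j j<m

-- A colouring is a function, so enumeration reaches it only up to pointwise agreement. Hence the
-- predicates searched are those that respect `_≈_`.
Searchable : {A : Set} → Rel A 0ℓ → Set₁
Searchable {A} _≈_ = ∀ {P : A → Set} → (∀ {a b} → a ≈ b → P a → P b) → Decidable P → Dec (∃ P)

Fin-searchable : ∀ {k} → Searchable {Fin k} _≡_
Fin-searchable _ P? = any? P?

Vector-searchable : ∀ {A : Set} {_≈_ : Rel A 0ℓ} → (∀ {a} → a ≈ a) → Searchable _≈_ →
  ∀ m → Searchable {Vector A m} (λ f g → ∀ i → f i ≈ g i)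
Vector-searchable ≈-refl search zero resp P? =
  map′ (Vector.[] ,_) (λ (f , pf) → resp (λ ()) pf) (P? Vector.[])
Vector-searchable ≈-refl search (suc m) resp P? =
  map′ (λ (f , a , p) → a Vector.∷ f , p)
       (λ (f , p) → f ∘ suc , f zero , resp (λ { zero → ≈-refl ; (suc i) → ≈-refl }) p)
       (Vector-searchable ≈-refl search m
         (λ f≈g (a , p) → a , resp (λ { zero → ≈-refl ; (suc i) → f≈g i }) p)
         (λ f → search (λ a≈b → resp λ { zero → a≈b ; (suc i) → ≈-refl }) (λ a → P? (a Vector.∷ f))))

_≈ᶜ_ : ∀ {n k} → Rel (TotalColouring n k) 0ℓ
c ≈ᶜ c′ = (∀ v → vcol c v ≡ vcol c′ v) × (∀ u v → acol c u v ≡ acol c′ u v)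

colouring-searchable : ∀ {n k} → Searchable (_≈ᶜ_ {n} {k})
colouring-searchable {n} resp P? =
  map′ (λ (f , g , p) → _ , p) (λ (c , p) → vcol c , acol c , p)
    (Vector-searchable refl Fin-searchable n
      (λ f≈ (g , p) → g , resp (f≈ , λ _ _ → refl) p)
      λ f → Vector-searchable (λ _ → refl) (Vector-searchable refl Fin-searchable n) n
        (λ g≈ → resp ((λ _ → refl) , g≈))
        λ g → P? record { vcol = f ; acol = g })

boundedList? : ∀ {n} m {P : List (Fin n) → Set} → Decidable P → Dec (∃ λ p → length p ≤ m × P p)
boundedList? zero P? = map′ (λ p → [] , z≤n , p) (λ { ([] , _ , p) → p }) (P? [])
boundedList? (suc m) {P} P? =
  map′ (λ { (inj₁ p) → [] , z≤n , p ; (inj₂ (x , p , l , q)) → x ∷ p , s≤s l , q })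
       (λ { ([] , _ , p) → inj₁ p ; (x ∷ p , s≤s l , q) → inj₂ (x , p , l , q) })
       (P? [] ⊎-dec any? (λ x → boundedList? m (P? ∘ (x ∷_))))

AllPairs-lookup : ∀ {A : Set} {R : Rel A 0ℓ} {xs} → AllPairs R xs →
  ∀ {i j} → i Fin.< j → R (lookup xs i) (lookup xs j)
AllPairs-lookup (px ∷ _)  {zero}  {suc j} _         = All.lookup px (∈-lookup j)
AllPairs-lookup (_  ∷ ps) {suc i} {suc j} (s≤s i<j) = AllPairs-lookup ps i<j

Unique⇒length≤ : ∀ {n} {xs : List (Fin n)} → Unique xs → length xs ≤ n
Unique⇒length≤ {n} {xs} uniq with length xs ≤? n
... | yes l≤n = l≤n
... | no  l≰n with i , j , i<j , eq ← pigeonhole (≰⇒> l≰n) (lookup xs) =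
  contradiction eq (AllPairs-lookup uniq i<j)

Unique? : ∀ {n} (xs : List (Fin n)) → Dec (Unique xs)
Unique? = DecUnique.unique? Fin._≟_

module _ {n} (D : Tournament n) where

  walk? : ∀ u v p → Dec (Walk D u v p)
  walk? u v []      = no λ ()
  walk? u v (x ∷ []) with u Fin.≟ x | u Fin.≟ v
  ... | yes refl | yes refl = yes here
  ... | no u≢x   | _        = no λ { here → u≢x refl ; (step _ ()) }
  ... | yes _    | no u≢v   = no λ { here → u≢v refl ; (step _ ()) }
  walk? u v (x ∷ w ∷ p) with u Fin.≟ x | T? (adj D u w) | walk? w v (w ∷ p)
  ... | yes refl | yes a | yes wk = yes (step a wk)
  ... | no u≢x   | _     | _      = no λ { (step _ _) → u≢x refl }
  ... | yes _    | no ¬a | _      = no λ { (step a here) → ¬a a ; (step a (step _ _)) → ¬a a }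
  ... | yes _    | yes _ | no ¬wk = no λ { (step _ here) → ¬wk here ; (step _ (step a wk)) → ¬wk (step a wk) }

  isPath? : ∀ u v p → Dec (IsPath D u v p)
  isPath? u v p = walk? u v p ×-dec Unique? p

  -- Minimality quantifies over all lists, but a shorter path has distinct vertices, hence at most
  -- `n` of them, so a bounded search decides it.
  isGeodesic? : ∀ u v p → Dec (IsGeodesic D u v p)
  isGeodesic? u v p = isPath? u v p ×-dec map′ to from (¬? shorter?)
    where
    Shorter : List (Fin n) → Set
    Shorter q = IsPath D u v q × length q < length p

    shorter? : Dec (∃ λ q → length q ≤ n × Shorter q)
    shorter? = boundedList? n λ q → isPath? u v q ×-dec (suc (length q) ≤? length p)

    to : ¬ (∃ λ q → length q ≤ n × Shorter q) → ∀ q → IsPath D u v q → length p ≤ length q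
    to none q path = ≮⇒≥ λ q<p → none (q , Unique⇒length≤ (proj₂ path) , path , q<p)

    from : (∀ q → IsPath D u v q → length p ≤ length q) → ¬ (∃ λ q → length q ≤ n × Shorter q)
    from min (q , _ , path , q<p) = <⇒≱ q<p (min q path)

arcColours-cong : ∀ {n k} {c c′ : TotalColouring n k} → c ≈ᶜ c′ → ∀ p → arcColours c p ≡ arcColours c′ p
arcColours-cong eq []          = refl
arcColours-cong eq (x ∷ [])    = refl
arcColours-cong eq (x ∷ y ∷ p) = cong₂ _∷_ (proj₂ eq x y) (arcColours-cong eq (y ∷ p))

-- Taking `Q` to be `IsPath D` or `IsGeodesic D` gives `TRConnecting D` or `STRConnecting D`, so one
-- decision procedure serves both numbers.
Rainbow : ∀ {n k} → (Fin n → Fin n → List (Fin n) → Set) → TotalColouring n k → Set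
Rainbow Q c = ∀ u v → u ≢ v → ∃ λ p → Q u v p × TotalRainbow c p

rainbow-resp : ∀ {n k} Q {c c′ : TotalColouring n k} → c ≈ᶜ c′ → Rainbow Q c → Rainbow Q c′
rainbow-resp Q eq conn u v u≢v with p , q , r ← conn u v u≢v =
  p , q , subst Unique (cong₂ _++_ (arcColours-cong eq p) (map-cong (proj₁ eq) (interior p))) r

rainbow? : ∀ {n} (Q : Fin n → Fin n → List (Fin n) → Set) → (∀ u v p → Dec (Q u v p)) →
  (∀ {u v p} → Q u v p → Unique p) → ∀ k → Dec (∃ λ (c : TotalColouring n k) → Rainbow Q c)
rainbow? {n} Q Q? uniq k = colouring-searchable (rainbow-resp Q) λ c →
  all? λ u → all? λ v → ¬? (u Fin.≟ v) →-dec
    map′ (λ (p , _ , q) → p , q) (λ (p , q , r) → p , Unique⇒length≤ (uniq q) , q , r)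
      (boundedList? n λ p → Q? u v p ×-dec Unique? _)

-- Lower bound, and existence of both numbers.

missingArc : ∀ {m} (D : Tournament (2 + m)) → ∃₂ λ u v → u ≢ v × ¬ Arc D u v
missingArc D with adj D zero (suc zero) in eq
... | false = zero , suc zero , (λ ()) , subst (¬_ ∘ T) (sym eq) (λ ())
... | true  = suc zero , zero , (λ ()) ,
  subst (¬_ ∘ T) (sym (trans (oneArc D (suc zero) zero λ ()) (cong not eq))) (λ ())

missingArc⇒3≤colours : ∀ {n k} {D : Tournament n} {u v} → u ≢ v → ¬ Arc D u v →
  (c : TotalColouring n k) → TRConnecting D c → 3 ≤ k
missingArc⇒3≤colours u≢v ¬a c conn with conn _ _ u≢v
... | _ , (here , _) , _ = contradiction refl u≢v
... | _ , (step a here , _) , _ = contradiction a ¬a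
-- Two arcs and the vertex between them give three colours; in the remaining cases the first three
-- arcs do.
... | _ , (step a (step b here) , _) , r = Unique⇒length≤ r
... | _ , (step a (step b (step _ here)) , _) , r = ≤-trans (s≤s (s≤s (s≤s z≤n))) (Unique⇒length≤ r)
... | _ , (step a (step b (step _ (step _ _))) , _) , r = ≤-trans (s≤s (s≤s (s≤s z≤n))) (Unique⇒length≤ r)

-- The optimal geodesic colouring also connects by paths, so the search for `t` can be bounded by
-- `s`, which yields `t ≤ s`. What then remains is to exhibit one colouring with few colours.
STRC⇒bounds : ∀ {m} (D : Tournament (2 + m)) k → ∃ (STRConnecting {k = k} D) →
  ∃₂ λ t s → IsTRC D t × IsSTRC D s × 3 ≤ t × t ≤ s × s ≤ k
STRC⇒bounds D k conn =
  let s , s≤k , (c , Sc) , Smin = least (rainbow? (IsGeodesic D) (isGeodesic? D) (proj₂ ∘ proj₁)) k conn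
      t , t≤s , (c′ , Tc) , Tmin = least (rainbow? (IsPath D) (isPath? D) proj₂) s
        (c , λ u v u≢v → let p , g , r = Sc u v u≢v in p , proj₁ g , r)
      u , v , u≢v , ¬a = missingArc D
  in t , s , ((c′ , Tc) , Tmin) , ((c , Sc) , Smin) , missingArc⇒3≤colours u≢v ¬a c′ Tc , t≤s , s≤k

-- Directed distance.

record Distance {n} (D : Tournament n) : Set where
  field
    dist       : Fin n → Fin n → ℕ
    dist-refl  : ∀ v → dist v v ≡ 0
    dist-arc   : ∀ {u w} v → Arc D u w → dist u v ≤ suc (dist w v)
    descend    : ∀ {u v} → u ≢ v → ∃ λ w → Arc D u w × dist u v ≡ suc (dist w v)

-- Repeated vertices are allowed, which makes this decidable by recursion on the length; a shortest
-- walk gives the distance all the same.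
Reach : ∀ {n} → Tournament n → ℕ → Fin n → Fin n → Set
Reach D zero    u v = u ≡ v
Reach D (suc k) u v = ∃ λ w → Arc D u w × Reach D k w v

reach? : ∀ {n} (D : Tournament n) u v k → Dec (Reach D k u v)
reach? D u v zero    = u Fin.≟ v
reach? D u v (suc k) = any? λ w → T? (adj D u w) ×-dec reach? D w v k

walk⇒reach : ∀ {n} {D : Tournament n} {u v p} → Walk D u v p → ∃ λ k → Reach D k u v
walk⇒reach here       = 0 , refl
walk⇒reach (step a w) with k , r ← walk⇒reach w = suc k , _ , a , r

distance : ∀ {n} {D : Tournament n} → StronglyConnected D → Distance D
distance {D = D} sc = record
  { dist      = dist
  ; dist-refl = λ v → n≤0⇒n≡0 (dist-min v v 0 refl)
  ; dist-arc  = λ {u} {w} v a → dist-min u v _ (w , a , dist-reach w v)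
  ; descend   = descend
  }
  where
  nearest = λ u v → let _ , walk , _ = sc u v ; k , r = walk⇒reach walk in least (reach? D u v) k r

  dist = λ u v → proj₁ (nearest u v)

  dist-reach : ∀ u v → Reach D (dist u v) u v
  dist-reach u v = proj₁ (proj₂ (proj₂ (nearest u v)))

  dist-min : ∀ u v k → Reach D k u v → dist u v ≤ k
  dist-min u v k r = ≮⇒≥ λ k< → proj₂ (proj₂ (proj₂ (nearest u v))) k k< r

  descend : ∀ {u v} → u ≢ v → ∃ λ w → Arc D u w × dist u v ≡ suc (dist w v)
  descend {u} {v} u≢v with dist u v | dist-reach u v | dist-min u v
  ... | zero  | u≡v         | _   = contradiction u≡v u≢v
  ... | suc k | w , a , r   | min = w , a , cong suc (≤-antisym
    (s≤s⁻¹ (min _ (w , a , dist-reach w v))) (dist-min w v k r))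


-- Geodesics described through distances.

interior-∷ʳ : ∀ {A : Set} (u : A) q v → interior (u ∷ q ++ v ∷ []) ≡ q
interior-∷ʳ u []          v = refl
interior-∷ʳ u (x ∷ [])    v = refl
interior-∷ʳ u (x ∷ y ∷ q) v = cong (x ∷_) (interior-∷ʳ x (y ∷ q) v)

AllPairs-map-All : ∀ {A : Set} {P : A → Set} {R S : A → A → Set} {xs} →
  (∀ {x y} → P x → R x y → S x y) → All P xs → AllPairs R xs → AllPairs S xs
AllPairs-map-All f []       []       = []
AllPairs-map-All f (p ∷ ps) (r ∷ rs) = All.map (f p) r ∷ AllPairs-map-All f ps rs

module Metric {n} {D : Tournament n} (distances : Distance D) where

  open Distance distances public

  dist-sep : ∀ {u v} → u ≢ v → 1 ≤ dist u v
  dist-sep u≢v with _ , _ , eq ← descend u≢v = subst (1 ≤_) (sym eq) (s≤s z≤n)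

  1≤dist⇒≢ : ∀ {u v} → 1 ≤ dist u v → u ≢ v
  1≤dist⇒≢ {u} 1≤ refl = contradiction (subst (1 ≤_) (dist-refl u) 1≤) λ ()

  triangle : ∀ u w v → dist u v ≤ dist u w + dist w v
  triangle u w v = go (dist u w) u refl
    where
    go : ∀ k u → dist u w ≡ k → dist u v ≤ k + dist w v
    go k u eq with u Fin.≟ w
    ... | yes refl = m≤n+m _ k
    go zero    u eq | no u≢w = contradiction (subst (1 ≤_) eq (dist-sep u≢w)) λ ()
    go (suc k) u eq | no u≢w with x , a , eq′ ← descend u≢w =
      ≤-trans (dist-arc v a) (s≤s (go k x (suc-injective (trans (sym eq′) eq))))

  walk⇒dist : ∀ {u v p} → Walk D u v p → suc (dist u v) ≤ length p
  walk⇒dist {u} here       = s≤s (≤-reflexive (dist-refl u))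
  walk⇒dist {v = v} (step a w) = s≤s (≤-trans (dist-arc v a) (walk⇒dist w))

  arc⇒dist≤1 : ∀ {u v} → Arc D u v → dist u v ≤ 1
  arc⇒dist≤1 {u} {v} a = ≤-trans (dist-arc v a) (s≤s (≤-reflexive (dist-refl v)))

  -- There is no forward arc at this distance, so the one arc joining the two vertices goes back.
  far⇒back : ∀ {x y} → 2 ≤ dist x y → Arc D y x
  far⇒back {x} {y} 2≤ with adj D y x in eq
  ... | true  = _
  ... | false = contradiction (arc⇒dist≤1 (subst T (sym (trans (oneArc D x y x≢y) (cong not eq))) _)) (<⇒≱ 2≤)
    where x≢y = 1≤dist⇒≢ (≤-trans (s≤s z≤n) 2≤)

  -- The counterpart of `descend` at the far end: descend from `u` until the next vertex is `y`.
  predecessor : ∀ {u y} → u ≢ y → ∃ λ p → Arc D p y × suc (dist u p) ≤ dist u y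
  predecessor {u} {y} = go _ u refl
    where
    go : ∀ k u → dist u y ≡ k → u ≢ y → ∃ λ p → Arc D p y × suc (dist u p) ≤ dist u y
    go zero    u eq u≢y = contradiction (subst (1 ≤_) eq (dist-sep u≢y)) λ ()
    go (suc k) u eq u≢y with w , a , eq′ ← descend u≢y with w Fin.≟ y
    ... | yes refl = u , a , subst (_≤ dist u y) (cong suc (sym (dist-refl u))) (dist-sep u≢y)
    ... | no w≢y
      with p , b , le ← go k w (suc-injective (trans (sym eq′) eq)) w≢y
      = p , b , ≤-trans (s≤s (≤-trans (dist-arc p a) le)) (≤-reflexive (sym eq′))

  -- x comes strictly before y on some geodesic from u to v, and is not its start.
  record Precedes (u v x y : Fin n) : Set where
    field
      after  : 1 ≤ dist u x
      apart  : 1 ≤ dist x y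
      total  : dist u x + dist x y + dist y v ≤ dist u v

  -- Being internal to some geodesic from `u` to `v`, in terms of distances; the triangle inequality
  -- turns `total` into an equality.
  record Between (u v x : Fin n) : Set where
    field
      after  : 1 ≤ dist u x
      before : 1 ≤ dist x v
      total  : dist u x + dist x v ≤ dist u v

  -- Besides the walk, this keeps the distance relations of its internal vertices, which are what
  -- the colour conditions refer to.
  record GeodesicInterior (u v : Fin n) (q : List (Fin n)) : Set where
    field
      walk    : Walk D u v (u ∷ q ++ v ∷ [])
      size    : suc (length q) ≡ dist u v
      between : All (Between u v) q
      ordered : AllPairs (Precedes u v) q

  module _ {u w v} (a : Arc D u w) (eq : dist u v ≡ suc (dist w v)) where

    between-step : ∀ {x} → Between w v x → Between u v x
    between-step {x} b = record
      -- If `x` were at distance 0 from `u`, then `u` would be no farther from `v` than `w` is,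
      -- against `eq`.
      { after  = ≮⇒≥ λ { (s≤s le) → <⇒≱ (≤-reflexive (sym eq)) (≤-trans (triangle u x v)
                   (≤-trans (+-monoˡ-≤ (dist x v) le) (≤-trans (m≤n+m (dist x v) (dist w x)) total))) }
      ; before = before
      ; total  = ≤-trans (+-monoˡ-≤ _ (dist-arc x a)) (≤-trans (s≤s total) (≤-reflexive (sym eq)))
      } where open Between b

    between-first : 1 ≤ dist w v → Between u v w
    between-first 1≤ = record
      { after  = ≮⇒≥ λ { (s≤s le) → <⇒≱ (≤-reflexive (sym eq)) (≤-trans (triangle u w v) (+-monoˡ-≤ (dist w v) le)) }
      ; before = 1≤
      ; total  = ≤-trans (+-monoˡ-≤ (dist w v) (arc⇒dist≤1 a)) (≤-reflexive (sym eq))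
      }

    precedes-first : ∀ {x} → 1 ≤ dist w v → Between w v x → Precedes u v w x
    precedes-first {x} 1≤ b = record
      { after = Between.after (between-first 1≤)
      ; apart = after
      ; total = subst (dist u w + dist w x + dist x v ≤_) (sym eq)
          (subst (_≤ suc (dist w v)) (sym (+-assoc (dist u w) _ _)) (+-mono-≤ (arc⇒dist≤1 a) total))
      } where open Between b

    precedes-step : ∀ {x y} → Between w v x → Precedes w v x y → Precedes u v x y
    precedes-step {x} {y} b p = record
      { after = Between.after (between-step b)
      ; apart = apart
      ; total = ≤-trans (+-monoˡ-≤ _ (+-monoˡ-≤ _ (dist-arc x a))) (≤-trans (s≤s total) (≤-reflexive (sym eq)))
      } where open Precedes p

  geodesicInterior : ∀ {u v} → u ≢ v → ∃ (GeodesicInterior u v)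
  geodesicInterior {u} {v} = go _ u refl
    where
    go : ∀ k u → dist u v ≡ k → u ≢ v → ∃ (GeodesicInterior u v)
    go zero    u eq u≢v = contradiction (subst (1 ≤_) eq (dist-sep u≢v)) λ ()
    go (suc k) u eq u≢v with w , a , eq′ ← descend u≢v with w Fin.≟ v
    ... | yes refl = [] , record { walk = step a here ; between = [] ; ordered = []
                                 ; size = sym (trans eq′ (cong suc (dist-refl w))) }
    ... | no w≢v
      with q , g ← go k w (suc-injective (trans (sym eq′) eq)) w≢v
      = w ∷ q , record
        { walk    = step a walk
        ; size    = trans (cong suc size) (sym eq′)
        ; between = between-first a eq′ 1≤ ∷ All.map (between-step a eq′) between
        ; ordered = All.map (precedes-first a eq′ 1≤) between
                  ∷ AllPairs-map-All (precedes-step a eq′) between ordered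
        }
      where
      open GeodesicInterior g
      1≤ = dist-sep w≢v

  between⇒precedes-end : ∀ {u v x} → Between u v x → Precedes u v x v
  between⇒precedes-end {u} {v} {x} b = record
    { after = after
    ; apart = before
    ; total = subst (_≤ dist u v) (sym (trans (cong (dist u x + dist x v +_) (dist-refl v)) (+-identityʳ _))) total
    } where open Between b

  module _ {u v q} (u≢v : u ≢ v) (g : GeodesicInterior u v q) where
    open GeodesicInterior g

    -- The list `q ++ v ∷ []` consists of the heads of the arcs, which determine the arc colours
    -- later.
    orderedToEnd : AllPairs (Precedes u v) (q ++ v ∷ [])
    orderedToEnd = AllPairs.++⁺ ordered ([] ∷ []) (All.map (λ b → between⇒precedes-end b ∷ []) between)

    isGeodesic : IsGeodesic D u v (u ∷ q ++ v ∷ [])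
    isGeodesic = (walk , distinct) , λ p (w , _) → ≤-trans (≤-reflexive (cong suc len)) (walk⇒dist w)
      where
      distinct : Unique (u ∷ q ++ v ∷ [])
      distinct = All.++⁺ (All.map (1≤dist⇒≢ ∘ Between.after) between) (u≢v ∷ [])
               ∷ AllPairs.map (1≤dist⇒≢ ∘ Precedes.apart) orderedToEnd
      len : length (q ++ v ∷ []) ≡ dist u v
      len = trans (length-++ q) (trans (+-comm (length q) 1) size)

  -- `α` has to tell apart all vertices of a geodesic but its start, `β` only the internal ones;
  -- hence the extra premise `1 ≤ dist y v`.
  record Palettes (a b : ℕ) : Set where
    field
      α      : Fin n → Fin a
      β      : Fin n → Fin b
      α-good : ∀ {u v x y} → Precedes u v x y → α x ≢ α y
      β-good : ∀ {u v x y} → Precedes u v x y → 1 ≤ dist y v → β x ≢ β y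

  -- An arc is coloured by its head, so a path shows each vertex but the first
  -- through α and each internal vertex through β.
  palettes⇒STRC : ∀ {a b} → Palettes a b → ∃ (STRConnecting {k = a + b} D)
  palettes⇒STRC {a} {b} pal = c , λ u v u≢v →
    let q , g = geodesicInterior u≢v
    in u ∷ q ++ v ∷ [] , isGeodesic u≢v g , rainbow u≢v g
    where
    open Palettes pal
    c : TotalColouring n (a + b)
    c = record { vcol = λ x → a ↑ʳ β x ; acol = λ _ x → α x ↑ˡ b }

    arcColours-head : ∀ u p → arcColours c (u ∷ p) ≡ map (λ x → α x ↑ˡ b) p
    arcColours-head u []      = refl
    arcColours-head u (x ∷ p) = cong (_ ∷_) (arcColours-head x p)

    ↑ˡ≢↑ʳ : ∀ i j → i ↑ˡ b ≢ a ↑ʳ j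
    ↑ˡ≢↑ʳ i j eq with () ← trans (sym (splitAt-↑ˡ a i b)) (trans (cong (splitAt a) eq) (splitAt-↑ʳ a b j))

    rainbow : ∀ {u v q} → u ≢ v → GeodesicInterior u v q → TotalRainbow c (u ∷ q ++ v ∷ [])
    rainbow {u} {v} {q} u≢v g =
      subst₂ (λ xs ys → Unique (xs ++ map (vcol c) ys))
        (sym (arcColours-head u (q ++ v ∷ []))) (sym (interior-∷ʳ u q v))
        (AllPairs.++⁺
          (AllPairs.map⁺ (AllPairs.map (λ p → α-good p ∘ ↑ˡ-injective b _ _) (orderedToEnd u≢v g)))
          (AllPairs.map⁺ (AllPairs.map (λ f → f ∘ ↑ʳ-injective a _ _) βs))
          (All.map⁺ (All.universal (λ x → All.map⁺ (All.universal (λ y → ↑ˡ≢↑ʳ (α x) (β y)) q)) (q ++ v ∷ []))))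
      where
      open GeodesicInterior g
      pairs : ∀ {xs} → All (Between u v) xs → AllPairs (Precedes u v) xs → AllPairs (λ x y → β x ≢ β y) xs
      pairs []       []       = []
      pairs (_ ∷ bs) (r ∷ rs) = All.zipWith (λ (b , p) → β-good p (Between.before b)) (bs , r) ∷ pairs bs rs
      βs = pairs between ordered

-- Maxima and identification maps on finite sets.

maximiser : ∀ {m} (f : Fin (suc m) → ℕ) → ∃ λ i → ∀ j → f j ≤ f i
maximiser f = argmax f zero (allFin _) , λ j → All.lookup (f[xs]≤f[argmax] {f = f} zero (allFin _)) (∈-allFin j)

SamePair : ∀ {A : Set} → A → A → A → A → Set
SamePair x y z w = (z ≡ x × w ≡ y) ⊎ (z ≡ y × w ≡ x)

-- `punchOut` removes `y`, and `y` itself is sent to the image of `x`.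
merge : ∀ {m} {x y : Fin (suc m)} → x ≢ y →
  ∃ λ (f : Fin (suc m) → Fin m) → ∀ {z w} → f z ≡ f w → z ≡ w ⊎ SamePair x y z w
merge {m} {x} {y} x≢y = f , collide
  where
  f : Fin (suc m) → Fin m
  f z with y Fin.≟ z
  ... | yes _   = punchOut (x≢y ∘ sym)
  ... | no  y≢z = punchOut y≢z

  collide : ∀ {z w} → f z ≡ f w → z ≡ w ⊎ SamePair x y z w
  collide {z} {w} eq with y Fin.≟ z | y Fin.≟ w
  ... | yes refl | yes refl = inj₁ refl
  ... | yes refl | no y≢w   = inj₂ (inj₂ (refl , sym (punchOut-injective (x≢y ∘ sym) y≢w eq)))
  ... | no y≢z   | yes refl = inj₂ (inj₁ (punchOut-injective y≢z (x≢y ∘ sym) eq , refl))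
  ... | no y≢z   | no y≢w   = inj₁ (punchOut-injective y≢z y≢w eq)

-- Merge twice. As `x′` and `y′` lie outside the first pair, each is alone in its fibre of `f`, so
-- the second merge identifies nothing else.
mergeDisjoint : ∀ {m} {x y x′ y′ : Fin (2 + m)} → x ≢ y → x′ ≢ y′ →
  x′ ≢ x → x′ ≢ y → y′ ≢ x → y′ ≢ y →
  ∃ λ (f : Fin (2 + m) → Fin m) → ∀ {z w} → f z ≡ f w →
    z ≡ w ⊎ SamePair x y z w ⊎ SamePair x′ y′ z w
mergeDisjoint {x = x} {y} {x′} {y′} x≢y x′≢y′ x′≢x x′≢y y′≢x y′≢y
  with f , f-collide ← merge x≢y
  with g , g-collide ← merge {x = f x′} {f y′} ([ x′≢y′ , [ x′≢x ∘ proj₁ , x′≢y ∘ proj₁ ] ] ∘ f-collide)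
  = g ∘ f , λ eq → combine (g-collide eq)
  where
  lone : ∀ {t z} → t ≢ x → t ≢ y → f z ≡ f t → z ≡ t
  lone t≢x t≢y eq with f-collide eq
  ... | inj₁ z≡t              = z≡t
  ... | inj₂ (inj₁ (_ , t≡y)) = contradiction t≡y t≢y
  ... | inj₂ (inj₂ (_ , t≡x)) = contradiction t≡x t≢x

  combine : ∀ {z w} → f z ≡ f w ⊎ SamePair (f x′) (f y′) (f z) (f w) →
            z ≡ w ⊎ SamePair x y z w ⊎ SamePair x′ y′ z w
  combine (inj₁ eq) with f-collide eq
  ... | inj₁ z≡w = inj₁ z≡w
  ... | inj₂ s   = inj₂ (inj₁ s)
  combine (inj₂ (inj₁ (p , q))) = inj₂ (inj₂ (inj₁ (lone x′≢x x′≢y p , lone y′≢x y′≢y q)))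
  combine (inj₂ (inj₂ (p , q))) = inj₂ (inj₂ (inj₂ (lone y′≢x y′≢y p , lone x′≢x x′≢y q)))

-- Merge `x` with `y`, then their common image with that of `z`; the fibres of `f` involved are `x`,
-- `y` and `z` alone.
mergeTriple : ∀ {m} {x y z : Fin (2 + m)} → x ≢ y → x ≢ z → y ≢ z →
  ∃ λ (f : Fin (2 + m) → Fin m) → ∀ {s t} → f s ≡ f t →
    s ≡ t ⊎ SamePair x y s t ⊎ SamePair x z s t ⊎ SamePair y z s t
mergeTriple {x = x} {y} {z} x≢y x≢z y≢z
  with f , f-collide ← merge x≢y
  with g , g-collide ← merge {x = f x} {f z} ([ x≢z , [ y≢z ∘ sym ∘ proj₂ , x≢y ∘ proj₁ ] ] ∘ f-collide)
  = g ∘ f , λ eq → combine (g-collide eq)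
  where
  fibre-x : ∀ {s} → f s ≡ f x → s ≡ x ⊎ s ≡ y
  fibre-x eq with f-collide eq
  ... | inj₁ s≡x              = inj₁ s≡x
  ... | inj₂ (inj₁ (s≡x , _)) = inj₁ s≡x
  ... | inj₂ (inj₂ (s≡y , _)) = inj₂ s≡y

  fibre-z : ∀ {s} → f s ≡ f z → s ≡ z
  fibre-z eq with f-collide eq
  ... | inj₁ s≡z              = s≡z
  ... | inj₂ (inj₁ (_ , z≡y)) = contradiction (sym z≡y) y≢z
  ... | inj₂ (inj₂ (_ , z≡x)) = contradiction (sym z≡x) x≢z

  combine : ∀ {s t} → f s ≡ f t ⊎ SamePair (f x) (f z) (f s) (f t) →
            s ≡ t ⊎ SamePair x y s t ⊎ SamePair x z s t ⊎ SamePair y z s t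
  combine (inj₁ eq) with f-collide eq
  ... | inj₁ s≡t = inj₁ s≡t
  ... | inj₂ s   = inj₂ (inj₁ s)
  combine (inj₂ (inj₁ (p , q))) with fibre-x p
  ... | inj₁ s≡x = inj₂ (inj₂ (inj₁ (inj₁ (s≡x , fibre-z q))))
  ... | inj₂ s≡y = inj₂ (inj₂ (inj₂ (inj₁ (s≡y , fibre-z q))))
  combine (inj₂ (inj₂ (p , q))) with fibre-x q
  ... | inj₁ t≡x = inj₂ (inj₂ (inj₁ (inj₂ (fibre-z p , t≡x))))
  ... | inj₂ t≡y = inj₂ (inj₂ (inj₂ (inj₂ (fibre-z p , t≡y))))

-- Pairs at distance at least 3.

threeOnes : ∀ {i j k} → 1 ≤ i → 1 ≤ j → 1 ≤ k → i + j + k ≤ 3 → i ≤ 1 × j ≤ 1 × k ≤ 1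
threeOnes 1≤i 1≤j 1≤k le =
    ≮⇒≥ (λ 2≤i → <⇒≱ (+-mono-≤ (+-mono-≤ 2≤i 1≤j) 1≤k) le)
  , ≮⇒≥ (λ 2≤j → <⇒≱ (+-mono-≤ (+-mono-≤ 1≤i 2≤j) 1≤k) le)
  , ≮⇒≥ (λ 2≤k → <⇒≱ (+-mono-≤ (+-mono-≤ 1≤i 1≤j) 2≤k) le)

module FarPairs {n} {D : Tournament n} (distances : Distance D) where

  open Metric distances

  -- If x is at distance at least 3 from y, then any predecessor p of y
  -- dominates x, so u ⋯ p → y → x can be shortened to u ⋯ p → x.
  far⇒¬backward : ∀ {u v x y} → 3 ≤ dist x y → ¬ Precedes u v y x
  far⇒¬backward {u} {v} {x} {y} 3≤ prec
    with p , p→y , closer ← predecessor (1≤dist⇒≢ (Precedes.after prec)) = <⇒≱ longer shorter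
    where
    open Precedes prec
    p→x : Arc D p x
    p→x = far⇒back (+-cancelʳ-≤ 1 2 _ (≤-trans 3≤ (≤-trans (triangle x p y) (+-monoʳ-≤ (dist x p) (arc⇒dist≤1 p→y)))))
    shorter : dist u x ≤ dist u y
    shorter = ≤-trans (triangle u p x) (≤-trans (+-monoʳ-≤ (dist u p) (arc⇒dist≤1 p→x))
                (subst (_≤ dist u y) (+-comm 1 (dist u p)) closer))
    longer : dist u y < dist u x
    longer = ≤-trans (≤-reflexive (+-comm 1 (dist u y))) (≤-trans (+-monoʳ-≤ (dist u y) apart)
      (+-cancelʳ-≤ (dist x v) _ _ (≤-trans total (triangle u x v))))

  -- The condition under which `x` and `y` may share a vertex colour: in neither order are both
  -- internal to one geodesic.
  InternallySeparate : Fin n → Fin n → Set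
  InternallySeparate x y = ∀ {u v z w} → SamePair x y z w → Precedes u v z w → ¬ (1 ≤ dist w v)

  InternallyProper : ∀ {b} → (Fin n → Fin b) → Set
  InternallyProper β = ∀ {u v x y} → Precedes u v x y → 1 ≤ dist y v → β x ≢ β y

  separate-sym : ∀ {x y} → InternallySeparate x y → InternallySeparate y x
  separate-sym sep s = sep (swap s)

  -- With `x` before `y`, at least one further arc on each side would give a distance of at least
  -- `dist x y + 2`. The other order is excluded by `far⇒¬backward`.
  far⇒separate : ∀ {x y} → 3 ≤ dist x y → (∀ u v → dist u v ≤ suc (dist x y)) → InternallySeparate x y
  far⇒separate {x} {y} 3≤ bound {u} {v} (inj₁ (refl , refl)) prec 1≤ =
    <⇒≱ (≤-trans (≤-reflexive (+-comm 1 (suc (dist x y)))) (+-mono-≤ (+-monoˡ-≤ (dist x y) after) 1≤))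
        (≤-trans total (bound u v))
    where open Precedes prec
  far⇒separate 3≤ bound (inj₂ (refl , refl)) prec _ = far⇒¬backward 3≤ prec

  far⇒≢ : ∀ {x y} → 3 ≤ dist x y → x ≢ y
  far⇒≢ 3≤ = 1≤dist⇒≢ (≤-trans (s≤s z≤n) 3≤)

  far-asym : ∀ {x y} → 3 ≤ dist x y → ¬ (3 ≤ dist y x)
  far-asym 3≤ 3≤′ = <⇒≱ (≤-trans (s≤s (s≤s z≤n)) 3≤′) (arc⇒dist≤1 (far⇒back (≤-trans (s≤s (s≤s z≤n)) 3≤)))

  internal⇒far : ∀ {u v z w} → Precedes u v z w → 1 ≤ dist w v → 3 ≤ dist u v
  internal⇒far prec 1≤ = ≤-trans (+-mono-≤ (+-mono-≤ after apart) 1≤) total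
    where open Precedes prec

-- Saving two vertex colours.

module _ {m} {D : Tournament (2 + m)} (distances : Distance D) where

  open Metric distances
  open FarPairs distances

  proper-disjoint : ∀ {x y x′ y′} → x ≢ y → x′ ≢ y′ → x′ ≢ x → x′ ≢ y → y′ ≢ x → y′ ≢ y →
    InternallySeparate x y → InternallySeparate x′ y′ → ∃ (InternallyProper {m})
  proper-disjoint x≢y x′≢y′ x′≢x x′≢y y′≢x y′≢y sep sep′
    with f , collide ← mergeDisjoint x≢y x′≢y′ x′≢x x′≢y y′≢x y′≢y
    = f , λ prec 1≤ eq → clash prec 1≤ (collide eq)
    where
    clash : ∀ {u v z w} → Precedes u v z w → 1 ≤ dist w v → ¬ (z ≡ w ⊎ _ ⊎ _)
    clash prec 1≤ (inj₁ z≡w)      = 1≤dist⇒≢ (Precedes.apart prec) z≡w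
    clash prec 1≤ (inj₂ (inj₁ s)) = sep s prec 1≤
    clash prec 1≤ (inj₂ (inj₂ s)) = sep′ s prec 1≤

  proper-triple : ∀ {x y z} → x ≢ y → x ≢ z → y ≢ z →
    InternallySeparate x y → InternallySeparate x z → InternallySeparate y z → ∃ (InternallyProper {m})
  proper-triple x≢y x≢z y≢z xy xz yz with f , collide ← mergeTriple x≢y x≢z y≢z
    = f , λ prec 1≤ eq → clash prec 1≤ (collide eq)
    where
    clash : ∀ {u v s t} → Precedes u v s t → 1 ≤ dist t v → ¬ (s ≡ t ⊎ _ ⊎ _ ⊎ _)
    clash prec 1≤ (inj₁ s≡t)             = 1≤dist⇒≢ (Precedes.apart prec) s≡t
    clash prec 1≤ (inj₂ (inj₁ s))        = xy s prec 1≤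
    clash prec 1≤ (inj₂ (inj₂ (inj₁ s))) = xz s prec 1≤
    clash prec 1≤ (inj₂ (inj₂ (inj₂ s))) = yz s prec 1≤

  -- The pairs are `x`, `p` and `s`, `y`. The vertices `s` and `p` need not lie on a common
  -- geodesic: what counts is that `dist x p` and `dist s y` are each at least the diameter minus 1,
  -- hence at least 3.
  diameter≥4⇒proper : ∀ {x y} → 4 ≤ dist x y → (∀ u v → dist u v ≤ dist x y) → ∃ (InternallyProper {m})
  diameter≥4⇒proper {x} {y} 4≤ maximal
    with s , x→s , eq ← descend (far⇒≢ (≤-trans (n≤1+n 3) 4≤))
    with p , p→y , closer ← predecessor (far⇒≢ (≤-trans (n≤1+n 3) 4≤))
    = proper-disjoint (far⇒≢ 3≤xp) (far⇒≢ 3≤sy) s≢x s≢p y≢x y≢p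
        (far⇒separate 3≤xp λ u v → ≤-trans (maximal u v) xy≤)
        (far⇒separate 3≤sy λ u v → ≤-trans (maximal u v) (≤-reflexive eq))
    where
    xy≤ : dist x y ≤ suc (dist x p)
    xy≤ = ≤-trans (triangle x p y) (≤-trans (+-monoʳ-≤ (dist x p) (arc⇒dist≤1 p→y)) (≤-reflexive (+-comm (dist x p) 1)))
    3≤xp : 3 ≤ dist x p
    3≤xp = s≤s⁻¹ (≤-trans 4≤ xy≤)
    3≤sy : 3 ≤ dist s y
    3≤sy = s≤s⁻¹ (≤-trans 4≤ (≤-reflexive eq))
    s≢x : s ≢ x
    s≢x refl = 1+n≢n (sym eq)
    s≢p : s ≢ p
    s≢p refl = <⇒≱ (≤-trans (s≤s (s≤s z≤n)) 3≤xp) (arc⇒dist≤1 x→s)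
    y≢x : y ≢ x
    y≢x = far⇒≢ (≤-trans (n≤1+n 3) 4≤) ∘ sym
    y≢p : y ≢ p
    y≢p refl = 1+n≰n closer

  -- Vertex colours when the diameter is at most 3.

  module DiameterThree (bound : ∀ u v → dist u v ≤ 3) where

    Far : Fin (2 + m) → Fin (2 + m) → Set
    Far x y = 3 ≤ dist x y ⊎ 3 ≤ dist y x

    Meets : (c a u v : Fin (2 + m)) → Set
    Meets c a u v = (u ≡ c ⊎ v ≡ c) ⊎ (u ≡ a ⊎ v ≡ a)

    Far⇒separate : ∀ {x y} → Far x y → InternallySeparate x y
    Far⇒separate = [ separate , separate-sym ∘ separate ]
      where
      separate : ∀ {x y} → 3 ≤ dist x y → InternallySeparate x y
      separate 3≤ = far⇒separate 3≤ λ u v → ≤-trans (bound u v) (≤-trans 3≤ (n≤1+n _))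

    Far⇒≢ : ∀ {x y} → Far x y → x ≢ y
    Far⇒≢ (inj₁ 3≤) = far⇒≢ 3≤
    Far⇒≢ (inj₂ 3≤) = far⇒≢ 3≤ ∘ sym

    unit-gaps : ∀ {u v z w} → Precedes u v z w → 1 ≤ dist w v → dist u z ≤ 1 × dist z w ≤ 1 × dist w v ≤ 1
    unit-gaps {u} {v} prec 1≤ = threeOnes after apart 1≤ (≤-trans total (bound u v))
      where open Precedes prec

    -- If `a` and `b` were the internal vertices `z`, `w` of a geodesic, it would have length 3, and
    -- the arc from `v` to `u` would close a directed 4-cycle. By `meets`, one of `u`, `v` is `c`,
    -- as neither is `a`. Opposite vertices of the cycle are within distance 2 both ways, but the
    -- one opposite `c` is `a` or `b`.
    far-leaves-separate : ∀ {c a b} → Far c a → Far c b → (∀ u v → 3 ≤ dist u v → Meets c a u v) →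
      InternallySeparate a b
    far-leaves-separate {c} {a} {b} ca cb meets {u} {v} {z} {w} same prec 1≤ = go (meets u v 3≤)
      where
      open Precedes prec
      3≤ = internal⇒far prec 1≤
      uz≤1 = proj₁ (unit-gaps prec 1≤)
      zw≤1 = proj₁ (proj₂ (unit-gaps prec 1≤))
      wv≤1 = proj₂ (proj₂ (unit-gaps prec 1≤))
      v→u = far⇒back (≤-trans (n≤1+n 2) 3≤)
      short : ∀ {i} → i ≤ 1 → ¬ (3 ≤ i)
      short i≤1 3≤i = <⇒≱ (≤-trans (n≤1+n 2) 3≤i) i≤1
      two-steps : ∀ {x y t} → dist x y ≤ 1 → dist y t ≤ 1 → ¬ (3 ≤ dist x t)
      two-steps {x} {y} {t} xy yt 3≤xt = <⇒≱ 3≤xt (≤-trans (triangle x y t) (+-mono-≤ xy yt))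
      z-end : SamePair a b z w → Far c z
      z-end (inj₁ (refl , _)) = ca
      z-end (inj₂ (refl , _)) = cb
      w-end : SamePair a b z w → Far c w
      w-end (inj₁ (_ , refl)) = cb
      w-end (inj₂ (_ , refl)) = ca
      off : ∀ {t} → t ≢ z → t ≢ w → t ≢ a
      off t≢z t≢w refl = [ t≢z ∘ sym ∘ proj₁ , t≢w ∘ sym ∘ proj₂ ] same
      go : ¬ Meets c a u v
      go (inj₁ (inj₁ refl)) with w-end same
      ... | inj₁ far = two-steps uz≤1 zw≤1 far
      ... | inj₂ far = two-steps wv≤1 (arc⇒dist≤1 v→u) far
      go (inj₁ (inj₂ refl)) with z-end same
      ... | inj₁ far = two-steps (arc⇒dist≤1 v→u) uz≤1 far
      ... | inj₂ far = two-steps zw≤1 wv≤1 far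
      go (inj₂ (inj₁ u≡a)) = off (1≤dist⇒≢ after) (λ { refl → short wv≤1 3≤ }) u≡a
      go (inj₂ (inj₂ v≡a)) = off (λ { refl → short uz≤1 3≤ }) (λ { refl → 1≤dist⇒≢ 1≤ refl }) v≡a

    shared⇒proper : ∀ {c a b} → Far c a → Far c b → a ≢ b →
      (∀ u v → 3 ≤ dist u v → Meets c a u v) → ∃ (InternallyProper {m})
    shared⇒proper ca cb a≢b meets = proper-triple (Far⇒≢ ca) (Far⇒≢ cb) a≢b
      (Far⇒separate ca) (Far⇒separate cb) (far-leaves-separate ca cb meets)

    -- A geodesic with two internal vertices must run from `x` to `y`, so these vertices are at
    -- distances 1 and 2 from `x`.
    lone⇒proper : ∀ {x y} → (∀ u v → 3 ≤ dist u v → u ≡ x × v ≡ y) → ∃ (InternallyProper {2})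
    lone⇒proper {x} {y} lone = layer , proper
      where
      layer : Fin (2 + m) → Fin 2
      layer z with dist x z ≤? 1
      ... | yes _ = 0F
      ... | no  _ = 1F
      proper : InternallyProper layer
      proper {u} {v} {z} {w} prec 1≤ with lone u v (internal⇒far prec 1≤)
      ... | refl , refl with dist x z ≤? 1 | dist x w ≤? 1
      ...   | yes _  | no _   = λ ()
      ...   | no 1≰  | _      = contradiction (proj₁ (unit-gaps prec 1≤)) 1≰
      ...   | yes _  | yes xw = contradiction
              (≤-trans (triangle x w y) (+-mono-≤ xw (proj₂ (proj₂ (unit-gaps prec 1≤)))))
              (<⇒≱ (internal⇒far prec 1≤))

    Disjoint : (x y u v : Fin (2 + m)) → Set
    Disjoint x y u v = (u ≢ x × v ≢ x) × (u ≢ y × v ≢ y)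

    ¬disjoint⇒meets : ∀ {x y u v} → ¬ Disjoint x y u v → Meets x y u v
    ¬disjoint⇒meets {x} {y} {u} {v} ¬dis with u Fin.≟ x | v Fin.≟ x | u Fin.≟ y | v Fin.≟ y
    ... | yes e | _     | _     | _     = inj₁ (inj₁ e)
    ... | no _  | yes e | _     | _     = inj₁ (inj₂ e)
    ... | no _  | no _  | yes e | _     = inj₂ (inj₁ e)
    ... | no _  | no _  | no _  | yes e = inj₂ (inj₂ e)
    ... | no p  | no q  | no r  | no s  = contradiction ((p , q) , (r , s)) ¬dis

    -- The search is first for a far pair disjoint from `x`, `y`, then for any other far pair, which
    -- must share a vertex with them. If there is none, the two layers fit into `m` colours because
    -- `2 ≤ m`.
    properInterior : 2 ≤ m → ∀ {x y} → 3 ≤ dist x y → ∃ (InternallyProper {m})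
    properInterior 2≤m {x} {y} 3≤ with any? (λ u → any? (λ v → (3 ≤? dist u v) ×-dec
      ((¬? (u Fin.≟ x) ×-dec ¬? (v Fin.≟ x)) ×-dec (¬? (u Fin.≟ y) ×-dec ¬? (v Fin.≟ y)))))
    ... | yes (u , v , far , (u≢x , v≢x) , (u≢y , v≢y)) =
      proper-disjoint (far⇒≢ 3≤) (far⇒≢ far) u≢x u≢y v≢x v≢y
        (Far⇒separate (inj₁ 3≤)) (Far⇒separate (inj₁ far))
    ... | no none with any? (λ u → any? (λ v → (3 ≤? dist u v) ×-dec ¬? ((u Fin.≟ x) ×-dec (v Fin.≟ y))))
    ...   | no lone = let β , good = lone⇒proper unique in
        (λ z → inject≤ (β z) 2≤m) , λ prec 1≤ eq → good prec 1≤ (inject≤-injective 2≤m 2≤m _ _ eq)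
      where
      unique : ∀ u v → 3 ≤ dist u v → u ≡ x × v ≡ y
      unique u v far = decidable-stable ((u Fin.≟ x) ×-dec (v Fin.≟ y)) λ ne → lone (u , v , far , ne)
    ...   | yes (u , v , far , ne) = share (meets u v far)
      where
      meets : ∀ u v → 3 ≤ dist u v → Meets x y u v
      meets u v far = ¬disjoint⇒meets λ dis → none (u , v , far , dis)
      meets′ : ∀ u v → 3 ≤ dist u v → Meets y x u v
      meets′ u v = swap ∘ meets u v
      -- The shared vertex is the centre `c`. The outer ends differ by `ne` if both pairs start, or
      -- both end, at the centre, and by `far-asym` otherwise.
      share : Meets x y u v → ∃ (InternallyProper {m})
      share (inj₁ (inj₁ refl)) = shared⇒proper (inj₁ 3≤) (inj₁ far) (λ { refl → ne (refl , refl) }) meets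
      share (inj₁ (inj₂ refl)) = shared⇒proper (inj₁ 3≤) (inj₂ far) (λ { refl → far-asym 3≤ far }) meets
      share (inj₂ (inj₁ refl)) = shared⇒proper (inj₂ 3≤) (inj₁ far) (λ { refl → far-asym 3≤ far }) meets′
      share (inj₂ (inj₂ refl)) = shared⇒proper (inj₂ 3≤) (inj₂ far) (λ { refl → ne (refl , refl) }) meets′

  -- Palettes by diameter, and the colour count.

  diameter≤2⇒palettes : (∀ u v → dist u v ≤ 2) → Palettes (2 + m) 1
  diameter≤2⇒palettes bound = record
    { α = id ; β = λ _ → 0F
    ; α-good = 1≤dist⇒≢ ∘ Precedes.apart
    ; β-good = λ prec 1≤ _ → <⇒≱ (internal⇒far prec 1≤) (bound _ _)
    }

  -- `x` and `y` may share a value of `α`: an `x` that is the head of an arc has an arc before it,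
  -- so going on to `y` would exceed the maximal distance, and `far⇒¬backward` excludes the other
  -- order.
  diameter≥3⇒palettes : ∀ {x y} → 3 ≤ dist x y → (∀ u v → dist u v ≤ dist x y) →
    ∀ {b} → ∃ (InternallyProper {b}) → Palettes (1 + m) b
  diameter≥3⇒palettes {x} {y} 3≤ maximal (β , good) with f , collide ← merge (far⇒≢ 3≤) = record
    { α = f ; β = β ; α-good = λ prec eq → clash prec (collide eq) ; β-good = good }
    where
    clash : ∀ {u v z w} → Precedes u v z w → ¬ (z ≡ w ⊎ SamePair x y z w)
    clash prec (inj₁ z≡w) = 1≤dist⇒≢ (Precedes.apart prec) z≡w
    clash {u} {v} prec (inj₂ (inj₁ (refl , refl))) =
      <⇒≱ (≤-trans (+-monoˡ-≤ (dist x y) after) (≤-trans (m≤m+n _ _) total)) (maximal u v)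
      where open Precedes prec
    clash prec (inj₂ (inj₂ (refl , refl))) = far⇒¬backward 3≤ prec

diametralPair : ∀ {m} (f : Fin (suc m) → Fin (suc m) → ℕ) → ∃₂ λ x y → ∀ u v → f u v ≤ f x y
diametralPair f =
  let x , x-max = maximiser (λ u → f u (proj₁ (maximiser (f u))))
  in x , proj₁ (maximiser (f x)) , λ u v → ≤-trans (proj₂ (maximiser (f u)) v) (x-max u)

-- For order n this is n + 1 ≤ 2n - 3, which fails at n = 3; hence the separate treatment of three
-- vertices.
small-diameter-bound : ∀ m → (4 + m) + 1 ≤ 2 * (4 + m) ∸ 3
small-diameter-bound m = s≤s (≤-trans (m≤n+m (3 + (m + 1)) m) (≤-reflexive (eq m)))
  where
  eq : ∀ m → m + (3 + (m + 1)) ≡ m + (4 + (m + 0))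
  eq = solve-∀

-- An equality: n - 1 arc colours and n - 2 vertex colours.
large-diameter-bound : ∀ m → (3 + m) + (2 + m) ≤ 2 * (4 + m) ∸ 3
large-diameter-bound m = ≤-reflexive (eq m)
  where
  eq : ∀ m → (3 + m) + (2 + m) ≡ 1 + (m + (4 + (m + 0)))
  eq = solve-∀

STRC-order≥4 : ∀ {m} {D : Tournament (4 + m)} → Distance D →
  ∃ λ k → k ≤ 2 * (4 + m) ∸ 3 × ∃ (STRConnecting {k = k} D)
STRC-order≥4 {m} {D} distances =
  let x , y , maximal = diametralPair dist in byDiameter x y maximal (dist x y ≤? 2) (4 ≤? dist x y)
  where
  open Metric distances

  byDiameter : ∀ x y → (∀ u v → dist u v ≤ dist x y) → Dec (dist x y ≤ 2) → Dec (4 ≤ dist x y) →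
    ∃ λ k → k ≤ 2 * (4 + m) ∸ 3 × ∃ (STRConnecting {k = k} D)
  byDiameter x y maximal (yes ≤2) _ = _ , small-diameter-bound m ,
    palettes⇒STRC (diameter≤2⇒palettes distances λ u v → ≤-trans (maximal u v) ≤2)
  byDiameter x y maximal (no ≰2) (yes 4≤) = _ , large-diameter-bound m ,
    palettes⇒STRC (diameter≥3⇒palettes distances (≰⇒> ≰2) maximal (diameter≥4⇒proper distances 4≤ maximal))
  byDiameter x y maximal (no ≰2) (no 4≰) = _ , large-diameter-bound m ,
    palettes⇒STRC (diameter≥3⇒palettes distances (≰⇒> ≰2) maximal
      (DiameterThree.properInterior distances (λ u v → ≤-trans (maximal u v) (≮⇒≥ 4≰)) (s≤s (s≤s z≤n)) (≰⇒> ≰2)))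

-- The vertex other than both arguments if these differ; the last clause serves `0F` and `2F` in
-- either order, and its value on equal arguments is a dummy.
third : Fin 3 → Fin 3 → Fin 3
third 0F 1F = 2F
third 1F 0F = 2F
third 1F 2F = 0F
third 2F 1F = 0F
third _  _  = 1F

-- On three vertices u → w → v is the only kind of long geodesic; its arcs get
-- the colours of v and u.
STRC-order3 : {D : Tournament 3} → Distance D → ∃ (STRConnecting {k = 3} D)
STRC-order3 distances = c , λ u v u≢v →
  let _ , g = geodesicInterior u≢v ; geo = isGeodesic u≢v g
  in _ , geo , rainbow _ (proj₂ (proj₁ geo))
  where
  open Metric distances
  c : TotalColouring 3 3
  c = record { vcol = id ; acol = third }

  rainbow : ∀ p → Unique p → TotalRainbow c p
  rainbow []              _ = []
  rainbow (x ∷ [])        _ = []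
  rainbow (x ∷ y ∷ [])    _ = [] ∷ []
  rainbow (x ∷ y ∷ z ∷ []) = from-yes (all? λ x → all? λ y → all? λ z →
    Unique? (x ∷ y ∷ z ∷ []) →-dec Unique? (third x y ∷ third y z ∷ y ∷ [])) x y z
  rainbow (_ ∷ _ ∷ _ ∷ _ ∷ _) uniq with s≤s (s≤s (s≤s ())) ← Unique⇒length≤ uniq

theorem16 : ∀ (n : ℕ) (T : Tournament n) → 3 ≤ n → StronglyConnected T →
    ∃₂ λ t s → IsTRC T t × IsSTRC T s × 3 ≤ t × t ≤ s × s ≤ 2 * n ∸ 3
theorem16 1 T (s≤s ()) sc
theorem16 2 T (s≤s (s≤s ())) sc
theorem16 3 T _ sc = STRC⇒bounds T 3 (STRC-order3 (distance sc))
theorem16 (suc (suc (suc (suc m)))) T _ sc =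
  let k , k≤ , conn = STRC-order≥4 (distance sc)
      t , s , trc , strc , 3≤t , t≤s , s≤k = STRC⇒bounds T k conn
  in t , s , trc , strc , 3≤t , t≤s , ≤-trans s≤k k≤
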